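{- Assume that $\omega_1\omega\not\longrightarrow(\omega_1\omega,3)^2$, and let $\tau$ be an $\langle\aleph_1,\aleph_1\rangle$-scattered linear order type of size at most $\aleph_1$. Then $\tau\not\longrightarrow(\omega_1^{\omega}\vee(\omega_1^{\omega})^*,3)^2$.
   Context: A linear order $P$ is $\kappa$-dense if $|P|>1$ and for all $a<_P b$ in $P$ the open interval between $a$ and $b$ in $P$ has cardinality at least $\kappa$. For infinite regular $\kappa$, a linear order (type) is $\kappa$-scattered if it has no $\kappa$-dense suborder. A linear order (type) is $\langle\kappa,\mu\rangle$-scattered if an order $P$ of that type is the union $\bigcup_{\zeta<\nu}P_\zeta$ of $\nu$ many $\kappa$-scattered suborders $P_\zeta$ of $P$ for some $\nu<\mu$. The size of an order type is the cardinality of any order of that type; $\varphi^*$ denotes the reverse of $\varphi$. $\omega_1\omega$ is the ordinal product ($\omega$ copies of $\omega_1$ placed one after another) and $\omega_1^\omega$ is ordinal exponentiation. For linear order types $\tau,\varphi_0,\dots,\varphi_k$ and $n<\omega$, $\tau\longrightarrow(\varphi_0\vee\dots\vee\varphi_k,n)^2$ means: whenever $P$ is a linear order of type $\tau$ and $f:[P]^2\to\{0,1\}$ (where $[P]^2$ is the set of two-element subsets of $P$), either there are $i\leq k$ and a suborder $Q\subseteq P$ of type $\varphi_i$ with $f$ constantly $0$ on $[Q]^2$, or there is $Q\subseteq P$ with $n$ elements with $f$ constantly $1$ on $[Q]^2$; $\not\longrightarrow$ is its negation. (With a single $\varphi_0$ this is $\tau\longrightarrow(\varphi_0,n)^2$.)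 -}

module Defs where

open import Level using (0ℓ; suc)
open import Data.Nat.Base as ℕ using (ℕ; _⊔_)
import Data.Nat.Properties as ℕₚ
open import Data.Fin.Base using (Fin; zero) renaming (suc to fsuc)
open import Data.Product.Base using (Σ; Σ-syntax; ∃; ∃-syntax; _×_; _,_; proj₁; proj₂)
open import Data.Product.Relation.Binary.Pointwise.NonDependent using (×-setoid)
open import Data.Product.Relation.Binary.Lex.Strict using (×-strictTotalOrder)
open import Data.Sum.Base using (_⊎_; inj₁; inj₂)
open import Data.Vec.Functional using (Vector)
open import Function.Base using (_∘_)
open import Function.Bundles using (Func; Injection; Bijection)
open import Induction.WellFounded using (WellFounded)
open import Relation.Binary.Bundles using (Setoid; StrictTotalOrder)
open import Relation.Binary.Definitions using (Tri; tri<; tri≈; tri>)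
import Relation.Binary.Construct.Flip.EqAndOrd as Flip
import Relation.Binary.Construct.On as On
open import Relation.Binary.Morphism.Structures using (IsOrderIsomorphism)
open import Relation.Binary.PropositionalEquality as ≡ using (_≡_)
open import Relation.Nullary.Negation.Core using (¬_; contradiction)
open import Relation.Unary using (Pred)
open import Relation.Unary.Relation.Binary.Equality using (≐-setoid)

-- Elements of a linear order are taken up to its equality _≈_: maps between
-- orders, cardinalities, colourings and indexed families below all respect it.
LinearOrder : Set (suc 0ℓ)
LinearOrder = StrictTotalOrder 0ℓ 0ℓ 0ℓ

open StrictTotalOrder using (Carrier)

∣_∣ : LinearOrder → Setoid 0ℓ 0ℓ
∣ P ∣ = StrictTotalOrder.Eq.setoid P

infix 4 _≅_ _≲_
infixl 8 _↾_

-- An order type is represented by any order of that type, so that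
-- "P has type φ" reads P ≅ φ.
_≅_ : LinearOrder → LinearOrder → Set
P ≅ Q = ∃ (IsOrderIsomorphism P._≈_ Q._≈_ P._<_ Q._<_)
  where
  module P = StrictTotalOrder P
  module Q = StrictTotalOrder Q

_≲_ : Setoid 0ℓ 0ℓ → Setoid 0ℓ 0ℓ → Set
A ≲ B = Injection A B

-- Q need not respect _≈_: since Σ inherits the equality of P, this is the
-- suborder on the ≈-closure of Q.
_↾_ : (P : LinearOrder) → Pred (Carrier P) 0ℓ → LinearOrder
P ↾ Q = On.strictTotalOrder P (proj₁ {B = Q})

interval : (P : LinearOrder) → Carrier P → Carrier P → LinearOrder
interval P a b = P ↾ λ x → a < x × x < b
  where open StrictTotalOrder P

below : (P : LinearOrder) → Carrier P → LinearOrder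
below P a = P ↾ λ x → x < a
  where open StrictTotalOrder P

ℕ-setoid : Setoid 0ℓ 0ℓ
ℕ-setoid = ≡.setoid ℕ

-- W is a well-order of type ω₁, the least uncountable ordinal.
record Isω₁ (W : LinearOrder) : Set where
  open StrictTotalOrder W using (_<_)
  field
    wellFounded      : WellFounded _<_
    uncountable      : ¬ (∣ W ∣ ≲ ℕ-setoid)
    below-countable  : ∀ a → ∣ below W a ∣ ≲ ℕ-setoid

-- Cardinals are initial ordinals: below, κ and μ are well-orders, κ serves as
-- a cardinal through its carrier, and an ordinal ν < μ is an element of μ,
-- identified with the initial segment below it.

Dense : LinearOrder → LinearOrder → Set
Dense κ P =
    (∃[ x ] ∃[ y ] ¬ x ≈ y)
  × (∀ a b → a < b → ∣ κ ∣ ≲ ∣ interval P a b ∣)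
  where open StrictTotalOrder P

Scattered : LinearOrder → LinearOrder → Set₁
Scattered κ P = ¬ (Σ[ Q ∈ Pred (Carrier P) 0ℓ ] Dense κ (P ↾ Q))

-- The family (P_ζ) for ζ < ν is a map of setoids, so that equal indices give
-- the same suborder.
⟨_,_⟩-Scattered : LinearOrder → LinearOrder → LinearOrder → Set₁
⟨ κ , μ ⟩-Scattered τ =
  Σ[ P ∈ LinearOrder ] P ≅ τ ×
  (Σ[ ν ∈ Carrier μ ]
   Σ[ F ∈ Func ∣ below μ ν ∣ (≐-setoid (Carrier P) 0ℓ) ]
     (∀ ζ → Scattered κ (P ↾ Func.to F ζ))
   × (∀ x → ∃[ ζ ] Func.to F ζ x))

-- Two-element subsets, listed in increasing order.
[_]² : LinearOrder → Setoid 0ℓ 0ℓ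
[ P ]² = On.setoid (×-setoid ∣ P ∣ ∣ P ∣)
  (λ (p : Σ[ x ∈ Carrier P ] Σ[ y ∈ Carrier P ] x < y) → proj₁ p , proj₁ (proj₂ p))
  where open StrictTotalOrder P using (_<_)

Colouring : LinearOrder → Set
Colouring P = Func [ P ]² (≡.setoid (Fin 2))

Homogeneous : (P : LinearOrder) → Colouring P → Fin 2 → Pred (Carrier P) 0ℓ → Set
Homogeneous P f c Q = ∀ x y (x<y : x < y) → Q x → Q y → Func.to f (x , y , x<y) ≡ c
  where open StrictTotalOrder P using (_<_)

-- τ ⟶[ φ₀ ∨ … ∨ φₖ , n ]²
_⟶[_,_]² : LinearOrder → ∀ {k} → Vector LinearOrder (ℕ.suc k) → ℕ → Set₁
τ ⟶[ φ , n ]² =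
  (P : LinearOrder) → P ≅ τ → (f : Colouring P) →
    (∃[ i ] Σ[ Q ∈ Pred (Carrier P) 0ℓ ] (P ↾ Q) ≅ φ i × Homogeneous P f zero Q)
  ⊎ (Σ[ Q ∈ Pred (Carrier P) 0ℓ ]
       Bijection ∣ P ↾ Q ∣ (≡.setoid (Fin n)) × Homogeneous P f (fsuc zero) Q)

_⟶̸[_,_]² : LinearOrder → ∀ {k} → Vector LinearOrder (ℕ.suc k) → ℕ → Set₁
τ ⟶̸[ φ , n ]² = ¬ (τ ⟶[ φ , n ]²)

infix 30 _*
infix 25 _·ω _^ω

_* : LinearOrder → LinearOrder
P * = Flip.strictTotalOrder P

-- The copy number in ω is the major coordinate.
_·ω : LinearOrder → LinearOrder
α ·ω = ×-strictTotalOrder ℕₚ.<-strictTotalOrder α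

-- Ordinal exponentiation: functions ω → α of finite support (equal to the
-- least element of α almost everywhere), compared at the greatest argument
-- where they differ.
module Power (α : LinearOrder) where
  open StrictTotalOrder α using (_≈_; _<_; compare; module Eq; <-resp-≈; irrefl)
    renaming (trans to <-trans)

  Least : Carrier α → Set
  Least a = ∀ b → ¬ b < a

  FinitelySupported : (ℕ → Carrier α) → Set
  FinitelySupported f = ∃[ N ] ∀ n → N ℕ.≤ n → Least (f n)

  C : Set
  C = ∃ FinitelySupported

  infix 4 _≈ᵉ_ _<ᵉ_

  _≈ᵉ_ : C → C → Set
  (f , _) ≈ᵉ (g , _) = ∀ n → f n ≈ g n

  _<ᵉ_ : C → C → Set
  (f , _) <ᵉ (g , _) = ∃[ n ] f n < g n × (∀ m → n ℕ.< m → f m ≈ g m)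

  least-unique : ∀ {a b} → Least a → Least b → a ≈ b
  least-unique {a} {b} la lb with compare a b
  ... | tri< a<b _ _ = contradiction a<b (lb a)
  ... | tri≈ _ a≈b _ = a≈b
  ... | tri> _ _ b<a = contradiction b<a (la b)

  irreflᵉ : ∀ {f g} → f ≈ᵉ g → ¬ f <ᵉ g
  irreflᵉ f≈g (n , fn<gn , _) = irrefl (f≈g n) fn<gn

  transᵉ : ∀ {f g h} → f <ᵉ g → g <ᵉ h → f <ᵉ h
  transᵉ {f , _} (n , f<g , f≈g) (m , g<h , g≈h) with ℕₚ.<-cmp n m
  ... | tri< n<m _ _ = m , proj₂ <-resp-≈ (Eq.sym (f≈g m n<m)) g<h ,
                       λ k m<k → Eq.trans (f≈g k (ℕₚ.<-trans n<m m<k)) (g≈h k m<k)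
  ... | tri≈ _ ≡.refl _ = n , <-trans f<g g<h , λ k n<k → Eq.trans (f≈g k n<k) (g≈h k n<k)
  ... | tri> _ _ m<n = n , proj₁ <-resp-≈ (g≈h n m<n) f<g ,
                       λ k n<k → Eq.trans (f≈g k n<k) (g≈h k (ℕₚ.<-trans m<n n<k))

  compareᵉ : ∀ f g → Tri (f <ᵉ g) (f ≈ᵉ g) (g <ᵉ f)
  compareᵉ F@(f , N , lf) G@(g , M , lg) =
    search (N ⊔ M) λ m N⊔M≤m →
      least-unique (lf m (ℕₚ.≤-trans (ℕₚ.m≤m⊔n N M) N⊔M≤m))
                   (lg m (ℕₚ.≤-trans (ℕₚ.m≤n⊔m N M) N⊔M≤m))
    where
    is< : F <ᵉ G → Tri (F <ᵉ G) (F ≈ᵉ G) (G <ᵉ F)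
    is< F<G = tri< F<G (λ F≈G → irreflᵉ {F} {G} F≈G F<G)
                   (λ G<F → irreflᵉ {F} {F} (λ _ → Eq.refl) (transᵉ {F} {G} {F} F<G G<F))

    is> : G <ᵉ F → Tri (F <ᵉ G) (F ≈ᵉ G) (G <ᵉ F)
    is> G<F = tri> (λ F<G → irreflᵉ {F} {F} (λ _ → Eq.refl) (transᵉ {F} {G} {F} F<G G<F))
                   (λ F≈G → irreflᵉ {G} {F} (Eq.sym ∘ F≈G) G<F) G<F

    search : ∀ K → (∀ m → K ℕ.≤ m → f m ≈ g m) → Tri (F <ᵉ G) (F ≈ᵉ G) (G <ᵉ F)
    search ℕ.zero agree =
      tri≈ (irreflᵉ {F} {G} F≈G) F≈G (irreflᵉ {G} {F} (Eq.sym ∘ F≈G))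
      where
      F≈G : F ≈ᵉ G
      F≈G n = agree n ℕ.z≤n
    search (ℕ.suc K) agree with compare (f K) (g K)
    ... | tri< fK<gK _ _ = is< (K , fK<gK , agree)
    ... | tri> _ _ gK<fK = is> (K , gK<fK , λ m K<m → Eq.sym (agree m K<m))
    ... | tri≈ _ fK≈gK _ = search K λ m K≤m → extend (ℕₚ.m≤n⇒m<n∨m≡n K≤m)
      where
      extend : ∀ {m} → K ℕ.< m ⊎ K ≡ m → f m ≈ g m
      extend (inj₁ K<m)    = agree _ K<m
      extend (inj₂ ≡.refl) = fK≈gK

_^ω : LinearOrder → LinearOrder
α ^ω = record
  { Carrier = C
  ; _≈_     = _≈ᵉ_
  ; _<_     = _<ᵉ_
  ; isStrictTotalOrder = record
    { isStrictPartialOrder = record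
      { isEquivalence = record
        { refl  = λ _ → Eq.refl
        ; sym   = λ f≈g n → Eq.sym (f≈g n)
        ; trans = λ f≈g g≈h n → Eq.trans (f≈g n) (g≈h n)
        }
      ; irrefl   = λ {f} {g} → irreflᵉ {f} {g}
      ; trans    = λ {f} {g} {h} → transᵉ {f} {g} {h}
      ; <-resp-≈ =
          (λ g≈h (n , f<g , e) → n , proj₁ <-resp-≈ (g≈h n) f<g , λ m n<m → Eq.trans (e m n<m) (g≈h m))
        , (λ g≈h (n , g<f , e) → n , proj₂ <-resp-≈ (g≈h n) g<f , λ m n<m → Eq.trans (Eq.sym (g≈h m)) (e m n<m))
      }
    ; compare = compareᵉ
    }
  }
  where
  open Power α
  open StrictTotalOrder α using (module Eq; <-resp-≈)

{-# OPTIONS --safe #-}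
module Submission where

-- Call a set n-small if it contains no copy of ω₁ⁿ or of its reverse. By the
-- regularity of ω₁ the n-small sets form a σ-ideal. Following the Milner–Rado
-- paradox and Hausdorff's analysis of scattered orders, τ is split into
-- countably many classes, the n-th being n-small: call a set σ-small if it can
-- be so split, and two points equivalent if the interval between them is
-- σ-small. Equivalence classes are σ-small, since an ω₁-sum of n-small sets is
-- (n+1)-small, and representatives of distinct classes would form an ℵ₁-dense
-- order, so an ℵ₁-scattered order is σ-small. Now inject the n-th class of τ into the
-- n-th copy of ω₁ in ω₁ω and pull back a colouring witnessing
-- ω₁ω ↛ (ω₁ω, 3)². A set homogeneous in colour 0 meets only finitely many
-- classes uncountably, so it is n-small for some n and has neither type ω₁^ω
-- nor its reverse.
--
-- In type theory excluded middle yields choice, because Dec carries a witness.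

open import Defs
open import Axiom.ExcludedMiddle using (ExcludedMiddle)
open import Axiom.Extensionality.Propositional using (Extensionality; implicit-extensionality)
open import Data.Bool.Base using (Bool)
open import Data.Empty using (⊥)
open import Data.Nat.Base as ℕ using (ℕ; zero; suc; _*_)
import Data.Nat.Properties as ℕₚ
open import Data.Fin.Base using (Fin) renaming (zero to fzero; suc to fsuc)
open import Data.Product.Base using (Σ; Σ-syntax; ∃; ∃-syntax; _×_; _,_; proj₁; proj₂)
open import Data.Sum.Base using (_⊎_; inj₁; inj₂)
open import Data.Unit.Base using (⊤; tt)
open import Data.Vec.Functional using (_∷_; [])
open import Function.Base using (_∘_; flip)
open import Function.Bundles using (Func; Injection; Bijection)
open import Induction.WellFounded using (Acc; acc; WfRec; module All; module FixPoint)
open import Level using (0ℓ)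
open import Relation.Binary.Bundles using (Setoid; StrictTotalOrder)
open import Relation.Binary.Core using (Rel)
open import Relation.Binary.Definitions using (tri<; tri≈; tri>)
open import Relation.Binary.Morphism.Structures using (IsOrderIsomorphism)
open import Relation.Binary.PropositionalEquality using (_≡_; setoid; refl; sym; trans; cong; subst; subst₂)
open import Relation.Nullary.Decidable.Core using (Dec; yes; no; does; decidable-stable)
open import Relation.Nullary.Negation.Core using (¬_; contradiction)
open import Relation.Unary.Relation.Binary.Equality using (≐-setoid)
open import Relation.Unary using (Pred; _⊆_; _∪_; ⋃)

-- Countable sets.

pair : ℕ → ℕ → ℕ
pair zero    b = suc (2 * b)
pair (suc a) b = 2 * pair a b

-- `pair a b` is 2^a (2b + 1), so parity decides whether the first component is zero and halving
-- descends to its predecessor.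
pair-injective : ∀ a {b} a′ {b′} → pair a b ≡ pair a′ b′ → a ≡ a′ × b ≡ b′
pair-injective zero    zero     eq = refl , ℕₚ.*-cancelˡ-≡ _ _ 2 (ℕₚ.suc-injective eq)
pair-injective zero {b} (suc a′) eq = contradiction (sym eq) (ℕₚ.even≢odd (pair a′ _) b)
pair-injective (suc a) zero {b} eq = contradiction eq (ℕₚ.even≢odd (pair a _) b)
pair-injective (suc a) (suc a′) eq with pair-injective a a′ (ℕₚ.*-cancelˡ-≡ _ _ 2 eq)
... | refl , b≡b′ = refl , b≡b′

-- The index is defined on the whole carrier and need not respect `_≈_`; `countable⇒≲` later makes
-- it a map of setoids.
record Countable (S : Setoid 0ℓ 0ℓ) (X : Pred (Setoid.Carrier S) 0ℓ) : Set where
  constructor _,_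
  open Setoid S
  field
    index           : Carrier → ℕ
    index-injective : ∀ {x y} → X x → X y → index x ≡ index y → x ≈ y

open Countable

countable-⊆ : ∀ {S X Y} → X ⊆ Y → Countable S Y → Countable S X
countable-⊆ X⊆Y (g , inj) = g , λ x y → inj (X⊆Y x) (X⊆Y y)

-- Weak order and intervals.

module Order (P : LinearOrder) where
  open StrictTotalOrder P public hiding (trans)
  open StrictTotalOrder P using () renaming (trans to <-trans) public

  infix 4 _≤_
  _≤_ : Rel Carrier 0ℓ
  x ≤ y = ¬ y < x

  <⇒≤ : ∀ {x y} → x < y → x ≤ y
  <⇒≤ x<y y<x = irrefl Eq.refl (<-trans x<y y<x)

  ≈⇒≤ : ∀ {x y} → x ≈ y → x ≤ y
  ≈⇒≤ x≈y y<x = irrefl (Eq.sym x≈y) y<x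

  ≤-antisym : ∀ {x y} → x ≤ y → y ≤ x → x ≈ y
  ≤-antisym {x} {y} x≤y y≤x with compare x y
  ... | tri< x<y _ _ = contradiction x<y y≤x
  ... | tri≈ _ x≈y _ = x≈y
  ... | tri> _ _ y<x = contradiction y<x x≤y

  ≤-<-trans : ∀ {x y z} → x ≤ y → y < z → x < z
  ≤-<-trans {x} {y} x≤y y<z with compare x y
  ... | tri< x<y _ _ = <-trans x<y y<z
  ... | tri≈ _ x≈y _ = <-respˡ-≈ (Eq.sym x≈y) y<z
  ... | tri> _ _ y<x = contradiction y<x x≤y

  ≤-trans : ∀ {x y z} → x ≤ y → y ≤ z → x ≤ z
  ≤-trans x≤y y≤z z<x = x≤y (≤-<-trans y≤z z<x)

  ≤-total : ∀ x y → x ≤ y ⊎ y ≤ x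
  ≤-total x y with compare x y
  ... | tri< x<y _ _ = inj₁ (<⇒≤ x<y)
  ... | tri≈ _ x≈y _ = inj₁ (≈⇒≤ x≈y)
  ... | tri> _ _ y<x = inj₂ (<⇒≤ y<x)

  increasing⇒injective : ∀ (Q : LinearOrder) (f : Carrier → StrictTotalOrder.Carrier Q) →
    (∀ {x y} → x < y → StrictTotalOrder._<_ Q (f x) (f y)) →
    ∀ {x y} → StrictTotalOrder._≈_ Q (f x) (f y) → x ≈ y
  increasing⇒injective Q f mono {x} {y} fx≈fy with compare x y
  ... | tri< x<y _ _ = contradiction (mono x<y) (StrictTotalOrder.irrefl Q fx≈fy)
  ... | tri≈ _ x≈y _ = x≈y
  ... | tri> _ _ y<x =
    contradiction (mono y<x) (StrictTotalOrder.irrefl Q (StrictTotalOrder.Eq.sym Q fx≈fy))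

  -- The closed interval with endpoints in either order, so that nearness of two points is visibly
  -- symmetric.
  Between : Carrier → Carrier → Pred Carrier 0ℓ
  Between x y z = (x ≤ z × z ≤ y) ⊎ (y ≤ z × z ≤ x)

  between-sym : ∀ {x y} → Between x y ⊆ Between y x
  between-sym (inj₁ p) = inj₂ p
  between-sym (inj₂ p) = inj₁ p

  between-split : ∀ {x} y {z} → Between x z ⊆ Between x y ∪ Between y z
  between-split y {x = w} (inj₁ (x≤w , w≤z)) with ≤-total w y
  ... | inj₁ w≤y = inj₁ (inj₁ (x≤w , w≤y))
  ... | inj₂ y≤w = inj₂ (inj₁ (y≤w , w≤z))
  between-split y {x = w} (inj₂ (z≤w , w≤x)) with ≤-total w y
  ... | inj₁ w≤y = inj₂ (inj₂ (z≤w , w≤y))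
  ... | inj₂ y≤w = inj₁ (inj₂ (y≤w , w≤x))

  between-convex : ∀ {x y z} → Between x y z → Between x z ⊆ Between x y
  between-convex (inj₁ (x≤z , z≤y)) (inj₁ (x≤w , w≤z)) = inj₁ (x≤w , ≤-trans w≤z z≤y)
  between-convex (inj₁ (x≤z , z≤y)) (inj₂ (z≤w , w≤x)) =
    inj₁ (≤-trans x≤z z≤w , ≤-trans w≤x (≤-trans x≤z z≤y))
  between-convex (inj₂ (y≤z , z≤x)) (inj₁ (x≤w , w≤z)) =
    inj₂ (≤-trans y≤z (≤-trans z≤x x≤w) , ≤-trans w≤z z≤x)
  between-convex (inj₂ (y≤z , z≤x)) (inj₂ (z≤w , w≤x)) = inj₂ (≤-trans y≤z z≤w , w≤x)

-- Excluded middle and choice.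

module Classical (em : ∀ ℓ → ExcludedMiddle ℓ) (ext : ∀ a b → Extensionality a b) where

  dec : ∀ {ℓ} (A : Set ℓ) → Dec A
  dec A = em _

  dne : ∀ {ℓ} {A : Set ℓ} → ¬ ¬ A → A
  dne = decidable-stable (em _)

  ¬∀⇒∃¬ : ∀ {a b} {A : Set a} {B : A → Set b} → ¬ (∀ x → B x) → ∃[ x ] ¬ B x
  ¬∀⇒∃¬ ¬∀ = dne λ ¬∃ → ¬∀ λ x → dne λ ¬Bx → ¬∃ (x , ¬Bx)

  -- A choice function: the result comes from deciding `A`, so it depends on the type alone and not
  -- on the element supplied.
  choose : ∀ {a} {A : Set a} → A → A
  choose {A = A} a with dec A
  ... | yes b = b
  ... | no _  = a

  choose-constant : ∀ {a} {A : Set a} (x y : A) → choose x ≡ choose y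
  choose-constant {A = A} x y with dec A
  ... | yes _ = refl
  ... | no ¬a = contradiction x ¬a

  -- Representatives of the ≈-classes: an element is chosen as a function of
  -- the Boolean characteristic function of its class, on which function
  -- extensionality makes equivalent elements agree.
  module Canonical (S : Setoid 0ℓ 0ℓ) where
    open Setoid S renaming (refl to ≈-refl; sym to ≈-sym; trans to ≈-trans)

    χ : Carrier → Carrier → Bool
    χ x y = does (dec (x ≈ y))

    representative : ∀ {φ} → ∃[ y ] χ y ≡ φ → Carrier
    representative w = proj₁ (choose w)

    canon : Carrier → Carrier
    canon x = representative (x , refl)

    χ-cong : ∀ {x y} → x ≈ y → χ x ≡ χ y
    χ-cong {x} {y} x≈y = ext _ _ λ z → agree z
      where
      agree : ∀ z → χ x z ≡ χ y z
      agree z with dec (x ≈ z) | dec (y ≈ z)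
      ... | yes _   | yes _   = refl
      ... | no _    | no _    = refl
      ... | yes x≈z | no y≉z  = contradiction (≈-trans (≈-sym x≈y) x≈z) y≉z
      ... | no x≉z  | yes y≈z = contradiction (≈-trans x≈y y≈z) x≉z

    representative-constant : ∀ {φ ψ} → φ ≡ ψ → (v : ∃[ y ] χ y ≡ φ) (w : ∃[ y ] χ y ≡ ψ) →
                              representative v ≡ representative w
    representative-constant refl v w = cong proj₁ (choose-constant v w)

    canon-cong : ∀ {x y} → x ≈ y → canon x ≡ canon y
    canon-cong x≈y = representative-constant (χ-cong x≈y) _ _

    χ-sound : ∀ {x y} → χ x ≡ χ y → x ≈ y
    χ-sound {x} {y} eq with dec (x ≈ y) | dec (y ≈ y) | cong (λ φ → φ y) eq
    ... | yes x≈y | _       | _ = x≈y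
    ... | no _    | no y≉y  | _ = contradiction ≈-refl y≉y
    ... | no _    | yes _   | ()

    canon-≈ : ∀ x → canon x ≈ x
    canon-≈ x = χ-sound (proj₂ (choose {A = ∃[ y ] χ y ≡ χ x} (x , refl)))

    canon-idem : ∀ x → canon (canon x) ≡ canon x
    canon-idem x = canon-cong (canon-≈ x)

  countable⇒≲ : ∀ {S} → Countable S (λ _ → ⊤) → S ≲ ℕ-setoid
  countable⇒≲ {S} (g , inj) = record
    { to        = g ∘ canon
    ; cong      = cong g ∘ canon-cong
    ; injective = λ {x} {y} eq →
        ≈-trans (≈-sym (canon-≈ x)) (≈-trans (inj tt tt eq) (canon-≈ y))
    }
    where
    open Canonical S
    open Setoid S renaming (sym to ≈-sym; trans to ≈-trans)

  -- Excluded middle fixes one `k` for each point of the union; `pair` codes it with the index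
  -- inside `Y k`.
  countable-⋃ : ∀ {S} {Y : ℕ → Pred (Setoid.Carrier S) 0ℓ} →
                (∀ k → Countable S (Y k)) → Countable S (⋃ ℕ Y)
  countable-⋃ {S} {Y} count = g , inj
    where
    open Setoid S using (Carrier; _≈_)
    g : Carrier → ℕ
    g x with dec (⋃ ℕ Y x)
    ... | yes (k , _) = pair k (index (count k) x)
    ... | no _        = 0
    inj : ∀ {x y} → ⋃ ℕ Y x → ⋃ ℕ Y y → g x ≡ g y → x ≈ y
    inj {x} {y} ∃Yx ∃Yy eq with dec (⋃ ℕ Y x) | dec (⋃ ℕ Y y)
    ... | no ¬∃Yx    | _       = contradiction ∃Yx ¬∃Yx
    ... | _          | no ¬∃Yy = contradiction ∃Yy ¬∃Yy
    ... | yes (k , Yx) | yes (k′ , Yy) with pair-injective k k′ eq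
    ...   | refl , eq′ = index-injective (count k) Yx Yy eq′

  countable-if-inhabited : ∀ {S X} → (∃ X → Countable S X) → Countable S X
  countable-if-inhabited {X = X} count with dec (∃ X)
  ... | yes ∃X = count ∃X
  ... | no ¬∃X = (λ _ → 0) , λ Xx _ _ → contradiction (_ , Xx) ¬∃X

-- Regularity of ω₁.

module Regular (em : ∀ ℓ → ExcludedMiddle ℓ) (ext : ∀ a b → Extensionality a b)
               (ω₁ : LinearOrder) (isω₁ : Isω₁ ω₁) where
  open Classical em ext public
  open Isω₁ isω₁
  open Order ω₁ renaming (Carrier to W)
  open Canonical ∣ ω₁ ∣

  minimal : ∀ {A : Set} (f : A → W) {B : Pred A 0ℓ} → ∃ B →
            ∃[ x ] B x × (∀ {y} → B y → f x ≤ f y)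
  minimal {A} f {B} (x , Bx) = descend x Bx (wellFounded (f x))
    where
    descend : ∀ x → B x → Acc _<_ (f x) → ∃[ x ] B x × (∀ {y} → B y → f x ≤ f y)
    descend x Bx (acc rs) with dec (∃[ y ] B y × f y < f x)
    ... | yes (y , By , fy<fx) = descend y By (rs fy<fx)
    ... | no ¬∃ = x , Bx , λ By fy<fx → ¬∃ (_ , By , fy<fx)

  ω₁-uncountable : ¬ Countable ∣ ω₁ ∣ (λ _ → ⊤)
  ω₁-uncountable = uncountable ∘ countable⇒≲

  -- Numbers the closed segment up to `ξ`: 0 is kept for `ξ` itself, hence the successor on the
  -- points below it.
  code : W → W → ℕ
  code ξ a with dec (a < ξ)
  ... | yes a<ξ = suc (Injection.to (below-countable ξ) (a , a<ξ))
  ... | no _    = 0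

  code-injective : ∀ ξ {a b} → a ≤ ξ → b ≤ ξ → code ξ a ≡ code ξ b → a ≈ b
  code-injective ξ {a} {b} a≤ξ b≤ξ eq with dec (a < ξ) | dec (b < ξ)
  ... | yes _   | yes _   = Injection.injective (below-countable ξ) (ℕₚ.suc-injective eq)
  ... | no a≮ξ  | no b≮ξ  = Eq.trans (≤-antisym a≤ξ a≮ξ) (≤-antisym b≮ξ b≤ξ)
  ... | yes _   | no _    = contradiction eq λ ()
  ... | no _    | yes _   = contradiction eq λ ()

  module _ {U : Pred W 0ℓ} (¬countable : ¬ Countable ∣ ω₁ ∣ U) where

    -- Otherwise the closed segments up to `s b`, for `b < a`, would cover `U`: countably many
    -- countable sets.
    unbounded : ∀ a (s : W → W) → (∀ {b c} → b ≈ c → s b ≡ s c) →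
                ∃[ u ] U u × (∀ {b} → b < a → s b < u)
    unbounded a s s-cong = dne λ none → ¬countable
      (countable-⊆ (exceeded none) (countable-⋃ pieces))
      where
      Y : ℕ → Pred W 0ℓ
      Y k u = ∃[ b ] (b < a) × (u ≤ s b) × code a b ≡ k

      exceeded : ¬ (∃[ u ] U u × (∀ {b} → b < a → s b < u)) → U ⊆ ⋃ ℕ Y
      exceeded none {u} Uu = dne λ ¬∃ →
        none (u , Uu , λ {b} b<a → dne λ sb≮u → ¬∃ (_ , b , b<a , sb≮u , refl))

      pieces : ∀ k → Countable ∣ ω₁ ∣ (Y k)
      -- All `b` with code `k` are equal, so a single witness `b₀` bounds the whole piece by `s b₀`.
      pieces k = countable-if-inhabited λ (u₀ , b₀ , b₀<a , _ , code≡) →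
        code (s b₀) , λ (b , b<a , u≤ , c) (b′ , b′<a , u′≤ , c′) →
          code-injective (s b₀)
            (subst (_ ≤_) (s-cong (code-injective a (<⇒≤ b<a) (<⇒≤ b₀<a) (trans c (sym code≡)))) u≤)
            (subst (_ ≤_) (s-cong (code-injective a (<⇒≤ b′<a) (<⇒≤ b₀<a) (trans c′ (sym code≡)))) u′≤)

    private
      -- `unbounded` expects a total function; the dummy value `a` is never consulted, since only
      -- arguments below `a` matter.
      extend : ∀ a → WfRec _<_ (λ _ → W) a → W → W
      extend a rec c with dec (c < a)
      ... | yes c<a = rec c<a
      ... | no _    = a

      extend-canon : ∀ a → WfRec _<_ (λ _ → W) a → W → W
      extend-canon a rec = extend a rec ∘ canon

      extend-cong : ∀ a (rec : WfRec _<_ (λ _ → W) a) {b c} → b ≈ c →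
                    extend-canon a rec b ≡ extend-canon a rec c
      extend-cong a rec b≈c = cong (extend a rec) (canon-cong b≈c)

      step : ∀ a → WfRec _<_ (λ _ → W) a → W
      step a rec = proj₁ (unbounded a (extend-canon a rec) (extend-cong a rec))

      rank : W → W
      rank = All.wfRec wellFounded _ (λ _ → W) step

      rank-unfold : ∀ {a} → rank a ≡ step a (λ {b} _ → rank b)
      rank-unfold = FixPoint.unfold-wfRec wellFounded (λ _ → W) step
        (λ a eq → cong (λ (rec : WfRec _<_ (λ _ → W) a) → step a rec)
                       (implicit-extensionality (ext _ _) (λ {y} → ext _ _ (eq {y}))))

      extend-≡ : ∀ {a c} (f : W → W) → c < a → extend a (λ {b} _ → f b) c ≡ f c
      extend-≡ {a} {c} f p with dec (c < a)
      ... | yes _ = refl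
      ... | no ¬p = contradiction p ¬p

    -- Well-founded recursion puts each value above all earlier ones. The recursion looks up earlier
    -- values at canonical arguments, hence the final `∘ canon`.
    enumerate : Σ[ F ∈ (W → W) ] (∀ a → U (F a)) × (∀ {a b} → a < b → F a < F b)
    enumerate = rank ∘ canon , (λ a → rank∈U (canon a)) , mono
      where
      rank∈U : ∀ a → U (rank a)
      rank∈U a = subst U (sym rank-unfold) (proj₁ (proj₂ (unbounded a _ (extend-cong a _))))

      mono : ∀ {a b} → a < b → rank (canon a) < rank (canon b)
      mono {a} {b} a<b = subst (rank (canon a) <_) (sym rank-unfold)
        (subst (_< _) (extend-≡ rank ca<cb) (proj₂ (proj₂ (unbounded (canon b) _ (extend-cong (canon b) _))) a<cb))
        where
        a<cb : a < canon b
        a<cb = <-respʳ-≈ (Eq.sym (canon-≈ b)) a<b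
        ca<cb : canon a < canon b
        ca<cb = <-respˡ-≈ (Eq.sym (canon-≈ a)) a<cb

  pigeonhole : (c : W → ℕ) → ∃[ k ] ¬ Countable ∣ ω₁ ∣ (λ a → c a ≡ k)
  pigeonhole c = ¬∀⇒∃¬ λ count → ω₁-uncountable
    (countable-⊆ {Y = ⋃ ℕ λ k a → c a ≡ k} (λ _ → _ , refl)
      (countable-⋃ count))

  w₀<w₁ : ∃[ a ] ∃[ b ] a < b
  w₀<w₁ = dne λ ¬∃ → ω₁-uncountable
    ((λ _ → 0) , λ {a} {b} _ _ _ → ≤-antisym (λ b<a → ¬∃ (_ , _ , b<a)) (λ a<b → ¬∃ (_ , _ , a<b)))

  w₀ w₁ : W
  w₀ = proj₁ w₀<w₁
  w₁ = proj₁ (proj₂ w₀<w₁)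

-- Small and σ-small sets.

module Ideals (em : ∀ ℓ → ExcludedMiddle ℓ) (ext : ∀ a b → Extensionality a b)
              (ω₁ : LinearOrder) (isω₁ : Isω₁ ω₁) where
  open Regular em ext ω₁ isω₁ public
  private
    module ω = Order ω₁
    open Canonical ∣ ω₁ ∣
  open ω using () renaming (Carrier to W) public

  -- Index n under Lex n is the ordinal power ω₁ⁿ.  Lex compares leading
  -- coordinates by ≡ rather than ≈, which only makes copies easier to come by.
  Index : ℕ → Set
  Index zero    = ⊤
  Index (suc n) = W × Index n

  Lex : ∀ n → Rel (Index n) 0ℓ
  Lex zero    _       _       = ⊥
  Lex (suc n) (a , l) (b , m) = a ω.< b ⊎ (a ≡ b × Lex n l m)

  index₀ : ∀ n → Index n
  index₀ zero    = tt
  index₀ (suc n) = w₀ , index₀ n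

  -- ω₁ⁿ is indivisible under countable colourings. By induction each block has a one-coloured
  -- subcopy; uncountably many blocks share that colour, and `enumerate` reindexes them by ω₁.
  homogeneous-copy : ∀ n (c : Index n → ℕ) →
    ∃[ k ] Σ[ φ ∈ (Index n → Index n) ]
      (∀ {l m} → Lex n l m → Lex n (φ l) (φ m)) × (∀ l → c (φ l) ≡ k)
  homogeneous-copy zero    c = c tt , (λ l → l) , (λ ()) , λ _ → refl
  homogeneous-copy (suc n) c = k , ψ , mono , c∘ψ
    where
    IH = λ a → homogeneous-copy n (λ l → c (a , l))
    k = proj₁ (pigeonhole (proj₁ ∘ IH))
    F = proj₁ (enumerate (proj₂ (pigeonhole (proj₁ ∘ IH))))
    F-colour = proj₁ (proj₂ (enumerate (proj₂ (pigeonhole (proj₁ ∘ IH)))))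
    F-mono = proj₂ (proj₂ (enumerate (proj₂ (pigeonhole (proj₁ ∘ IH)))))
    ψ : Index (suc n) → Index (suc n)
    ψ (a , l) = F a , proj₁ (proj₂ (IH (F a))) l
    mono : ∀ {l m} → Lex (suc n) l m → Lex (suc n) (ψ l) (ψ m)
    mono (inj₁ a<b)          = inj₁ (F-mono a<b)
    mono {a , _} (inj₂ (refl , l<m)) = inj₂ (refl , proj₁ (proj₂ (proj₂ (IH (F a)))) l<m)
    c∘ψ : ∀ l → c (ψ l) ≡ k
    c∘ψ (a , l) = trans (proj₂ (proj₂ (proj₂ (IH (F a)))) l) (F-colour a)

  record Copy {A : Set} (_<_ : Rel A 0ℓ) (n : ℕ) (X : Pred A 0ℓ) : Set where
    constructor copy
    field
      embed      : Index n → A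
      embed∈     : ∀ l → X (embed l)
      increasing : ∀ {l m} → Lex n l m → embed l < embed m

  record Small {A : Set} (_<_ : Rel A 0ℓ) (n : ℕ) (X : Pred A 0ℓ) : Set where
    constructor small
    field
      no-copy         : ¬ Copy _<_ n X
      no-reverse-copy : ¬ Copy (flip _<_) n X

  record σSmall {A : Set} (_<_ : Rel A 0ℓ) (X : Pred A 0ℓ) : Set where
    constructor ranked
    field
      rank       : A → ℕ
      rank-small : ∀ n → Small _<_ n (λ x → X x × rank x ≡ n)

  open Small
  open σSmall

  module _ {A : Set} {_<_ : Rel A 0ℓ} where

    copy-⊆ : ∀ {n} {X Y : Pred A 0ℓ} → X ⊆ Y → Copy _<_ n X → Copy _<_ n Y
    copy-⊆ X⊆Y (copy E E∈X mono) = copy E (X⊆Y ∘ E∈X) mono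

    -- Colour each point of the copy by the piece it was found in and pass to a homogeneous subcopy.
    copy-⋃ : ∀ {n} {Y : ℕ → Pred A 0ℓ} → Copy _<_ n (⋃ ℕ Y) → ∃[ k ] Copy _<_ n (Y k)
    copy-⋃ {n} {Y} (copy E E∈Y mono) with homogeneous-copy n (proj₁ ∘ E∈Y)
    ... | k , φ , φ-mono , colour = k ,
      copy (E ∘ φ) (λ l → subst (λ k → Y k (E (φ l))) (colour l) (proj₂ (E∈Y (φ l)))) (mono ∘ φ-mono)

    copy-pred : ∀ {n} {X : Pred A 0ℓ} → Copy _<_ (suc n) X → Copy _<_ n X
    copy-pred (copy E E∈X mono) =
      copy (λ l → E (w₀ , l)) (λ l → E∈X (w₀ , l)) (λ l<m → mono (inj₂ (refl , l<m)))

    copy-inhabited : ∀ {n} {X : Pred A 0ℓ} → Copy _<_ n X → ∃ X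
    copy-inhabited (copy E E∈X _) = E (index₀ _) , E∈X (index₀ _)

  module _ {A : Set} {_<_ : Rel A 0ℓ} where

    small-⊆ : ∀ {n} {X Y : Pred A 0ℓ} → X ⊆ Y → Small _<_ n Y → Small _<_ n X
    small-⊆ X⊆Y (small ¬c ¬c*) = small (¬c ∘ copy-⊆ X⊆Y) (¬c* ∘ copy-⊆ X⊆Y)

    small-⋃ : ∀ {n} {Y : ℕ → Pred A 0ℓ} → (∀ k → Small _<_ n (Y k)) → Small _<_ n (⋃ ℕ Y)
    small-⋃ σ = small (λ c → let k , c′ = copy-⋃ c in no-copy (σ k) c′)
                      (λ c → let k , c′ = copy-⋃ c in no-reverse-copy (σ k) c′)

    small-mono : ∀ {m n} {X : Pred A 0ℓ} → m ℕ.≤′ n → Small _<_ m X → Small _<_ n X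
    small-mono ℕ.≤′-refl       s = s
    small-mono (ℕ.≤′-step m≤n) s with small-mono m≤n s
    ... | small ¬c ¬c* = small (¬c ∘ copy-pred) (¬c* ∘ copy-pred)

    small-if-inhabited : ∀ {n} {X : Pred A 0ℓ} → (∃ X → Small _<_ n X) → Small _<_ n X
    small-if-inhabited s = small (λ c → no-copy (s (copy-inhabited c)) c)
                                 (λ c → no-reverse-copy (s (copy-inhabited c)) c)

    σSmall-flip : ∀ {X : Pred A 0ℓ} → σSmall _<_ X → σSmall (flip _<_) X
    σSmall-flip (ranked r s) = ranked r λ n → small (no-reverse-copy (s n)) (no-copy (s n))

    σSmall-⊆ : ∀ {X Y : Pred A 0ℓ} → X ⊆ Y → σSmall _<_ Y → σSmall _<_ X
    σSmall-⊆ X⊆Y (ranked r s) = ranked r λ n → small-⊆ (λ (x , rx≡n) → X⊆Y x , rx≡n) (s n)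

    -- Each point keeps its rank from one chosen piece, so the n-th class is a countable union of
    -- n-small sets.
    σSmall-⋃ : ∀ {Y : ℕ → Pred A 0ℓ} → (∀ k → σSmall _<_ (Y k)) → σSmall _<_ (⋃ ℕ Y)
    σSmall-⋃ {Y} σ = ranked r λ n → small-⊆ split (small-⋃ λ k → rank-small (σ k) n)
      where
      r : A → ℕ
      r x with dec (⋃ ℕ Y x)
      ... | yes (k , _) = rank (σ k) x
      ... | no _        = 0
      split : ∀ {n} → (λ x → ⋃ ℕ Y x × r x ≡ n) ⊆ ⋃ ℕ (λ k x → Y k x × rank (σ k) x ≡ n)
      split {x = x} (∃Yx , rx≡n) with dec (⋃ ℕ Y x)
      ... | yes (k , Yx) = k , Yx , rx≡n
      ... | no ¬∃Yx      = contradiction ∃Yx ¬∃Yx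

    σSmall-∪ : ∀ {X Y : Pred A 0ℓ} → σSmall _<_ X → σSmall _<_ Y → σSmall _<_ (X ∪ Y)
    σSmall-∪ {X} {Y} σX σY = σSmall-⊆ cover (σSmall-⋃ {Z} λ { zero → σX ; (suc _) → σY })
      where
      Z : ℕ → Pred A 0ℓ
      Z zero    = X
      Z (suc _) = Y
      cover : X ∪ Y ⊆ ⋃ ℕ Z
      cover (inj₁ Xx) = 0 , Xx
      cover (inj₂ Yx) = 1 , Yx

    σSmall-if-inhabited : ∀ {X : Pred A 0ℓ} → (∃ X → σSmall _<_ X) → σSmall _<_ X
    σSmall-if-inhabited {X} σ with dec (∃ X)
    ... | yes ∃X = σ ∃X
    ... | no ¬∃X = ranked (λ _ → 0) λ n → small-if-inhabited λ (x , Xx , _) → contradiction (x , Xx) ¬∃X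

  -- Orders of size at most ℵ₁.

  module Bounded (P : LinearOrder) (e : ∣ P ∣ ≲ ∣ ω₁ ∣) where
    open Order P
    open Injection e using (to; injective) renaming (cong to to-cong)

    -- The image of `X` in ω₁ is uncountable, so it can be enumerated and lifted back. The result
    -- increases along `to`, not necessarily in `P`.
    uncountable-enumerate : ∀ {X} → ¬ Countable ∣ P ∣ X →
      Σ[ G ∈ (W → Carrier) ] (∀ a → X (G a)) × (∀ {a b} → a ω.< b → to (G a) ω.< to (G b))
    uncountable-enumerate {X} ¬countable =
      (λ a → proj₁ (F∈U a)) , (λ a → proj₁ (proj₂ (F∈U a))) ,
      λ {a} {b} a<b → ω.<-respˡ-≈ (ω.Eq.sym (proj₂ (proj₂ (F∈U a))))
                        (ω.<-respʳ-≈ (ω.Eq.sym (proj₂ (proj₂ (F∈U b)))) (F-mono a<b))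
      where
      U : Pred W 0ℓ
      U w = ∃[ x ] X x × to x ω.≈ w
      ¬U : ¬ Countable ∣ ω₁ ∣ U
      ¬U (g , inj) = ¬countable
        (g ∘ to , λ Xx Xy eq → injective (inj (_ , Xx , ω.Eq.refl) (_ , Xy , ω.Eq.refl) eq))
      F∈U = proj₁ (proj₂ (enumerate ¬U))
      F-mono = proj₂ (proj₂ (enumerate ¬U))

    countable⇒small : ∀ {X} → Countable ∣ P ∣ X → Small _<_ 1 X
    countable⇒small (g , inj) = small
      (λ (copy E E∈X mono) → ω₁-uncountable
        ( (λ a → g (E (a , tt)))
        , λ _ _ eq → ω.increasing⇒injective P (λ a → E (a , tt)) (λ a<b → mono (inj₁ a<b))
                                            (inj (E∈X _) (E∈X _) eq)))
      (λ (copy E E∈X mono) → ω₁-uncountable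
        ( (λ a → g (E (a , tt)))
        , λ _ _ eq → ω.increasing⇒injective (P *) (λ a → E (a , tt)) (λ a<b → mono (inj₁ a<b))
                                            (inj (E∈X _) (E∈X _) eq)))

    -- Sort the x ∈ X by the least a < ω₁ such that the a-th element of P lies in X
    -- and not below x: a weakly increasing function of x. As initial segments of
    -- ω₁ are countable, a bounded part of a rank class lies in countably many
    -- initial segments of X.
    cofinal : ∀ {X} → (∀ y → X y → σSmall _<_ (λ x → X x × x ≤ y)) → σSmall _<_ X
    cofinal {X} segment = ranked r λ { zero → small₀ ; (suc n) → small₊ n }
      where
      D : W → Pred Carrier 0ℓ
      D a x = X x × ∃[ y ] X y × to y ω.≈ a × x ≤ y

      D-σSmall : ∀ a → σSmall _<_ (D a)
      D-σSmall a = σSmall-if-inhabited λ (_ , _ , y₀ , Xy₀ , y₀≈a , _) →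
        σSmall-⊆ (λ (Xx , y , _ , y≈a , x≤y) →
                    Xx , ≤-trans x≤y (≈⇒≤ (injective (ω.Eq.trans y≈a (ω.Eq.sym y₀≈a)))))
                 (segment y₀ Xy₀)

      R : W → Carrier → ℕ
      R a = rank (D-σSmall a)

      -- Minimality determines `a` only up to equality in ω₁, which `R` need not respect;
      -- `canon a ≡ a` pins it down.
      Least : Carrier → W → Set
      Least x a = canon a ≡ a × D a x × (∀ {b} → D b x → a ω.≤ b)

      least : ∀ {x} → X x → ∃ (Least x)
      least {x} Xx with minimal to {λ y → X y × x ≤ y} (x , Xx , ≈⇒≤ Eq.refl)
      ... | y , (Xy , x≤y) , y-min =
        canon (to y) , canon-idem (to y) ,
        (Xx , y , Xy , ω.Eq.sym (canon-≈ (to y)) , x≤y) ,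
        λ (_ , z , Xz , z≈b , x≤z) → ω.≤-trans (ω.≈⇒≤ (canon-≈ (to y)))
                                       (ω.≤-trans (y-min (Xz , x≤z)) (ω.≈⇒≤ z≈b))

      r : Carrier → ℕ
      r x with dec (∃ (Least x))
      -- The shift by one pays for gluing: n-small bounded parts make an (n + 1)-small class. Class
      -- 0 stays empty on `X`.
      ... | yes (a , _) = suc (R a x)
      ... | no _        = 0

      r-least : ∀ {x} → X x → ∃[ a ] Least x a × r x ≡ suc (R a x)
      r-least {x} Xx with dec (∃ (Least x))
      ... | yes (a , x-least) = a , x-least , refl
      ... | no ¬∃             = contradiction (least Xx) ¬∃

      small₀ : Small _<_ 0 (λ x → X x × r x ≡ 0)
      small₀ = small-if-inhabited λ (x , Xx , rx≡0) →
        contradiction (trans (sym (proj₂ (proj₂ (r-least Xx)))) rx≡0) λ ()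

      -- Least indices of points up to `p` are at most `aₚ`, so there are countably many, and each
      -- contributes part of the n-th class of one `D a`.
      bounded : ∀ {n p} {Z : Pred Carrier 0ℓ} → X p →
                (∀ {x} → Z x → (X x × r x ≡ suc n) × x ≤ p) → Small _<_ n Z
      bounded {n} {p} {Z} Xp Z⊆ with least Xp
      ... | aₚ , _ , (_ , y , Xy , y≈aₚ , p≤y) , _ = small-⊆ cover (small-⋃ piece)
        where
        Y : ℕ → Pred Carrier 0ℓ
        Y k x = ∃[ a ] (canon a ≡ a × a ω.≤ aₚ × code aₚ a ≡ k) × D a x × R a x ≡ n

        cover : Z ⊆ ⋃ ℕ Y
        cover {x} Zx with Z⊆ Zx
        ... | (Xx , rx≡) , x≤p with r-least Xx
        ...   | a , (canonical , Dax , a-min) , rx≡′ =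
          code aₚ a , a , (canonical , a-min (Xx , y , Xy , y≈aₚ , ≤-trans x≤p p≤y) , refl) ,
          Dax , ℕₚ.suc-injective (trans (sym rx≡′) rx≡)

        piece : ∀ k → Small _<_ n (Y k)
        piece k = small-if-inhabited λ (x₀ , a₀ , (can₀ , a₀≤ , code₀) , _) →
          small-⊆ (λ {x} (a , (can , a≤ , code≡) , Dax , Rax) →
                     subst (λ a → D a x × R a x ≡ n)
                       (trans (sym can) (trans (canon-cong (code-injective aₚ a≤ a₀≤ (trans code≡ (sym code₀)))) can₀))
                       (Dax , Rax))
                  (rank-small (D-σSmall a₀) n)

      -- In a copy of ω₁ⁿ⁺¹ the block at `w₀` lies below a point of the block at `w₁`, so it is a
      -- bounded copy of ω₁ⁿ. In a reverse copy the two blocks swap roles.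
      small₊ : ∀ n → Small _<_ (suc n) (λ x → X x × r x ≡ suc n)
      small₊ n = small
        (λ (copy E E∈ mono) → no-copy
          (bounded {n} {E (w₁ , index₀ n)} {λ x → ∃[ l ] x ≡ E (w₀ , l)} (proj₁ (E∈ _))
             λ { (l , refl) → E∈ _ , <⇒≤ (mono (inj₁ (proj₂ (proj₂ w₀<w₁)))) })
          (copy (λ l → E (w₀ , l)) (λ l → l , refl) (λ l<m → mono (inj₂ (refl , l<m)))))
        (λ (copy E E∈ mono) → no-reverse-copy
          (bounded {n} {E (w₀ , index₀ n)} {λ x → ∃[ l ] x ≡ E (w₁ , l)} (proj₁ (E∈ _))
             λ { (l , refl) → E∈ _ , <⇒≤ (mono (inj₁ (proj₂ (proj₂ w₀<w₁)))) })
          (copy (λ l → E (w₁ , l)) (λ l → l , refl) (λ l<m → mono (inj₂ (refl , l<m)))))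

-- Scattered orders are σ-small.

module Decomposition (em : ∀ ℓ → ExcludedMiddle ℓ) (ext : ∀ a b → Extensionality a b)
                     (ω₁ : LinearOrder) (isω₁ : Isω₁ ω₁) where
  open Ideals em ext ω₁ isω₁ public
  open Isω₁ isω₁
  open Countable
  open σSmall
  private module ω = Order ω₁

  module _ (P : LinearOrder) (e : ∣ P ∣ ≲ ∣ ω₁ ∣) where
    open Order P
    open Bounded P e

    countable⇒σSmall : ∀ {X} → Countable ∣ P ∣ X → σSmall _<_ X
    -- Class 1 is the first possible one: a 0-small set is empty.
    countable⇒σSmall count = ranked (λ _ → 1) λ n → small-if-inhabited λ { (_ , _ , refl) →
      small-⊆ proj₁ (countable⇒small count) }

    infix 4 _~_
    _~_ : Rel Carrier 0ℓ
    x ~ y = σSmall _<_ (Between x y)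

    ≈⇒~ : ∀ {x y} → x ≈ y → x ~ y
    ≈⇒~ {x} {y} x≈y = countable⇒σSmall ((λ _ → 0) , λ u v _ → Eq.trans (Eq.sym (unique u)) (unique v))
      where
      unique : ∀ {z} → Between x y z → x ≈ z
      unique (inj₁ (x≤z , z≤y)) = ≤-antisym x≤z (≤-trans z≤y (≈⇒≤ (Eq.sym x≈y)))
      unique (inj₂ (y≤z , z≤x)) = ≤-antisym (≤-trans (≈⇒≤ x≈y) y≤z) z≤x

    ~-sym : ∀ {x y} → x ~ y → y ~ x
    ~-sym = σSmall-⊆ between-sym

    ~-trans : ∀ {x y z} → x ~ y → y ~ z → x ~ z
    ~-trans {y = y} x~y y~z = σSmall-⊆ (between-split y) (σSmall-∪ x~y y~z)

    ~-convex : ∀ {x y z} → x ~ y → Between x y z → x ~ z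
    ~-convex x~y z∈ = σSmall-⊆ (between-convex z∈) x~y

    ~-setoid : Setoid 0ℓ 0ℓ
    ~-setoid = record
      { _≈_ = _~_
      ; isEquivalence = record { refl = ≈⇒~ Eq.refl ; sym = ~-sym ; trans = ~-trans }
      }

    -- Above `c`, each segment up to a point `y` of the class lies between `c` and `y`, so `cofinal`
    -- applies; below `c` the same argument runs in the reversed order.
    class-σSmall : ∀ c → σSmall _<_ (c ~_)
    class-σSmall c = σSmall-⊆ split (σSmall-∪ upper lower)
      where
      split : (c ~_) ⊆ (λ x → c ~ x × c ≤ x) ∪ (λ x → c ~ x × x ≤ c)
      split {x} c~x with ≤-total c x
      ... | inj₁ c≤x = inj₁ (c~x , c≤x)
      ... | inj₂ x≤c = inj₂ (c~x , x≤c)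

      upper : σSmall _<_ (λ x → c ~ x × c ≤ x)
      upper = cofinal λ y (c~y , _) → σSmall-⊆ (λ ((_ , c≤x) , x≤y) → inj₁ (c≤x , x≤y)) c~y

      lower : σSmall _<_ (λ x → c ~ x × x ≤ c)
      lower = σSmall-flip (Bounded.cofinal (P *) e λ y (c~y , _) →
        σSmall-flip (σSmall-⊆ (λ ((_ , x≤c) , y≤x) → inj₂ (y≤x , x≤c)) c~y))

    -- Inequivalent representatives have uncountably many representatives
    -- between them: otherwise countably many classes would cover the interval.
    scattered⇒σSmall : Scattered ω₁ P → σSmall _<_ (λ _ → ⊤)
    scattered⇒σSmall scattered = σSmall-if-inhabited λ (c , _) →
      σSmall-⊆ (λ {x} _ → dne λ c≁x → scattered (Q , inequivalent c x c≁x , dense)) (class-σSmall c)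
      where
      open Canonical ~-setoid
      module C = Canonical ∣ ω₁ ∣

      Q : Pred Carrier 0ℓ
      Q q = canon q ≡ q

      inequivalent : ∀ x y → ¬ x ~ y → ∃[ p ] ∃[ q ] ¬ StrictTotalOrder._≈_ (P ↾ Q) p q
      inequivalent x y x≁y = (canon x , canon-idem x) , (canon y , canon-idem y) , λ cx≈cy →
        x≁y (~-trans (~-sym (canon-≈ x)) (~-trans (≈⇒~ cx≈cy) (canon-≈ y)))

      module Interval {a b : Carrier} (a<b : a < b) where

        S : Pred Carrier 0ℓ
        S q = Q q × a < q × q < b

        countable⇒~ : Countable ∣ P ∣ S → a ~ b
        countable⇒~ count =
          σSmall-⊆ cover (σSmall-∪ (class-σSmall a) (σSmall-∪ (class-σSmall b) (σSmall-⋃ class)))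
          where
          Y : ℕ → Pred Carrier 0ℓ
          Y k x = S (canon x) × index count (canon x) ≡ k

          class : ∀ k → σSmall _<_ (Y k)
          class k = σSmall-if-inhabited λ (x₀ , S₀ , k₀) →
            σSmall-⊆ (λ {x} (Sx , kx) →
                        ~-trans (≈⇒~ (index-injective count S₀ Sx (trans k₀ (sym kx)))) (canon-≈ x))
                     (class-σSmall (canon x₀))

          order : ∀ {x} → Between a b x → a ≤ x × x ≤ b
          order (inj₁ p)           = p
          order (inj₂ (b≤x , x≤a)) = contradiction a<b (≤-trans b≤x x≤a)

          cover : Between a b ⊆ (a ~_) ∪ ((b ~_) ∪ ⋃ ℕ Y)
          cover {x} x∈ with dec (a ~ x) | dec (b ~ x)
          ... | yes a~x | _       = inj₁ a~x
          ... | no _    | yes b~x = inj₂ (inj₁ b~x)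
          ... | no a≁x  | no b≁x  = inj₂ (inj₂ (_ , (canon-idem x , a<cx , cx<b) , refl))
            where
            x~cx : x ~ canon x
            x~cx = ~-sym (canon-≈ x)
            a<cx : a < canon x
            -- A representative at or below `a` would place `a` between two equivalent points, and
            -- classes are convex.
            a<cx = dne λ cx≤a → a≁x (~-sym (~-convex x~cx (inj₂ (cx≤a , proj₁ (order x∈)))))
            cx<b : canon x < b
            cx<b = dne λ b≤cx → b≁x (~-sym (~-convex x~cx (inj₁ (proj₂ (order x∈) , b≤cx))))

      dense : ∀ a b → StrictTotalOrder._<_ (P ↾ Q) a b → ∣ ω₁ ∣ ≲ ∣ interval (P ↾ Q) a b ∣
      dense (a , Qa) (b , Qb) a<b = enumeration⇒≲ (uncountable-enumerate ¬countable)
        where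
        ¬countable : ¬ Countable ∣ P ∣ (Interval.S a<b)
        ¬countable count =
          -- If `a ~ b`, these two representatives coincide, against `a < b`.
          irrefl (Eq.reflexive (trans (sym Qa) (trans (canon-cong (Interval.countable⇒~ a<b count)) Qb))) a<b

        enumeration⇒≲ :
          Σ[ G ∈ (W → Carrier) ] (∀ w → Interval.S a<b (G w)) ×
            (∀ {v w} → v ω.< w → Injection.to e (G v) ω.< Injection.to e (G w)) →
          ∣ ω₁ ∣ ≲ ∣ interval (P ↾ Q) (a , Qa) (b , Qb) ∣
        enumeration⇒≲ (G , G∈S , increasing) = record
          { to        = λ w → let Qq , q∈ = G∈S (C.canon w) in (G (C.canon w) , Qq) , q∈
          ; cong      = λ v≈w → Eq.reflexive (cong G (C.canon-cong v≈w))
          ; injective = λ {v} {w} eq →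
              ω.Eq.trans (ω.Eq.sym (C.canon-≈ v))
                (ω.Eq.trans (ω.increasing⇒injective ω₁ (Injection.to e ∘ G) increasing (Injection.cong e eq))
                            (C.canon-≈ w))
          }

    σSmall-suborder : ∀ {Q : Pred Carrier 0ℓ} →
      σSmall (StrictTotalOrder._<_ (P ↾ Q)) (λ _ → ⊤) → σSmall _<_ Q
    σSmall-suborder {Q} (ranked r s) = ranked r′ λ n → small
      (λ (copy E E∈ mono) → Small.no-copy (s n)
        (copy (λ l → E l , proj₁ (r′-rank (E∈ l))) (λ l → tt , proj₂ (r′-rank (E∈ l))) mono))
      (λ (copy E E∈ mono) → Small.no-reverse-copy (s n)
        (copy (λ l → E l , proj₁ (r′-rank (E∈ l))) (λ l → tt , proj₂ (r′-rank (E∈ l))) mono))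
      where
      r′ : Carrier → ℕ
      r′ x with dec (Q x)
      ... | yes Qx = r (x , Qx)
      ... | no _   = 0
      -- `r` may depend on the membership proof, so the proof found by `dec` is returned rather than
      -- the given one.
      r′-rank : ∀ {x n} → Q x × r′ x ≡ n → Σ[ Qx ∈ Q x ] r (x , Qx) ≡ n
      r′-rank {x} (Qx , eq) with dec (Q x)
      ... | yes Qx′ = Qx′ , eq
      ... | no ¬Qx  = contradiction Qx ¬Qx

  scattered-suborder-σSmall : ∀ P → ∣ P ∣ ≲ ∣ ω₁ ∣ → (Q : Pred (StrictTotalOrder.Carrier P) 0ℓ) →
    Scattered ω₁ (P ↾ Q) → σSmall (StrictTotalOrder._<_ P) Q
  scattered-suborder-σSmall P e Q scattered =
    σSmall-suborder P e (scattered⇒σSmall (P ↾ Q) e↾Q scattered)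
    where
    e↾Q : ∣ P ↾ Q ∣ ≲ ∣ ω₁ ∣
    e↾Q = record { to = Injection.to e ∘ proj₁ ; cong = Injection.cong e ; injective = Injection.injective e }

  -- Ordinals below ω₁ are countable, so the family is reindexed by ℕ; as `F` respects equality,
  -- each code stands for one suborder.
  union-σSmall : ∀ P → ∣ P ∣ ≲ ∣ ω₁ ∣ → ∀ ν (F : Func ∣ below ω₁ ν ∣ (≐-setoid (StrictTotalOrder.Carrier P) 0ℓ)) →
    (∀ ζ → Scattered ω₁ (P ↾ Func.to F ζ)) → (∀ x → ∃[ ζ ] Func.to F ζ x) →
    σSmall (StrictTotalOrder._<_ P) (λ _ → ⊤)
  union-σSmall P e ν F scattered covers =
    σSmall-⊆ (λ {x} _ → let ζ , Fζx = covers x in _ , ζ , Fζx , refl) (σSmall-⋃ piece)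
    where
    Y : ℕ → Pred (StrictTotalOrder.Carrier P) 0ℓ
    Y k x = ∃[ ζ ] Func.to F ζ x × Injection.to (below-countable ν) ζ ≡ k
    piece : ∀ k → σSmall (StrictTotalOrder._<_ P) (Y k)
    piece k = σSmall-if-inhabited λ (_ , ζ₀ , _ , k₀) →
      σSmall-⊆ (λ (ζ , Fζx , kζ) →
                  proj₁ (Func.cong F (Injection.injective (below-countable ν) {ζ} {ζ₀} (trans kζ (sym k₀)))) Fζx)
               (scattered-suborder-σSmall P e (Func.to F ζ₀) (scattered ζ₀))

-- Isomorphisms and pulled-back colourings.

module Inverse {P Q : LinearOrder} (P≅Q : P ≅ Q) where
  private
    module P = Order P
    module Q = Order Q
  open IsOrderIsomorphism (proj₂ P≅Q) public using (injective; cancel)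

  to : P.Carrier → Q.Carrier
  to = proj₁ P≅Q

  from : Q.Carrier → P.Carrier
  from y = proj₁ (IsOrderIsomorphism.surjective (proj₂ P≅Q) y)

  to∘from : ∀ y → to (from y) Q.≈ y
  to∘from y = proj₂ (IsOrderIsomorphism.surjective (proj₂ P≅Q) y) P.Eq.refl

  from-mono : ∀ {x y} → x Q.< y → from x P.< from y
  from-mono x<y = cancel (Q.<-respˡ-≈ (Q.Eq.sym (to∘from _)) (Q.<-respʳ-≈ (Q.Eq.sym (to∘from _)) x<y))

  from-cong : ∀ {x y} → x Q.≈ y → from x P.≈ from y
  from-cong x≈y = injective (Q.Eq.trans (to∘from _) (Q.Eq.trans x≈y (Q.Eq.sym (to∘from _))))

  from-injective : ∀ {x y} → from x P.≈ from y → x Q.≈ y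
  from-injective eq =
    Q.Eq.trans (Q.Eq.sym (to∘from _)) (Q.Eq.trans (IsOrderIsomorphism.cong (proj₂ P≅Q) eq) (to∘from _))

module Pullback (P P₀ : LinearOrder) (h : ∣ P ∣ ≲ ∣ P₀ ∣) (f₀ : Colouring P₀) where
  private
    module P = Order P
    module P₀ = Order P₀
  open Injection h using (to; injective) renaming (cong to to-cong)

  -- `h` need not preserve order, so a pair is coloured as an unordered pair of `P₀`; the value on
  -- equal points is a dummy.
  colour : P₀.Carrier → P₀.Carrier → Fin 2
  colour u v with P₀.compare u v
  ... | tri< u<v _ _ = Func.to f₀ (u , v , u<v)
  ... | tri≈ _ _ _   = fzero
  ... | tri> _ _ v<u = Func.to f₀ (v , u , v<u)

  colour-< : ∀ {u v} (u<v : u P₀.< v) → colour u v ≡ Func.to f₀ (u , v , u<v)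
  colour-< {u} {v} u<v with P₀.compare u v
  ... | tri< _ _ _   = Func.cong f₀ (P₀.Eq.refl , P₀.Eq.refl)
  ... | tri≈ u≮v _ _ = contradiction u<v u≮v
  ... | tri> u≮v _ _ = contradiction u<v u≮v

  colour-> : ∀ {u v} (v<u : v P₀.< u) → colour u v ≡ Func.to f₀ (v , u , v<u)
  colour-> {u} {v} v<u with P₀.compare u v
  ... | tri< _ _ v≮u = contradiction v<u v≮u
  ... | tri≈ _ _ v≮u = contradiction v<u v≮u
  ... | tri> _ _ _   = Func.cong f₀ (P₀.Eq.refl , P₀.Eq.refl)

  colour-≈ : ∀ {u v} → u P₀.≈ v → colour u v ≡ fzero
  colour-≈ {u} {v} u≈v with P₀.compare u v
  ... | tri< _ u≉v _ = contradiction u≈v u≉v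
  ... | tri≈ _ _ _   = refl
  ... | tri> _ u≉v _ = contradiction u≈v u≉v

  colour-cong : ∀ {u v u′ v′} → u P₀.≈ u′ → v P₀.≈ v′ → colour u v ≡ colour u′ v′
  colour-cong {u} {v} u≈u′ v≈v′ with P₀.compare u v
  ... | tri< u<v _ _ = trans (Func.cong f₀ (u≈u′ , v≈v′))
                             (sym (colour-< (P₀.<-respˡ-≈ u≈u′ (P₀.<-respʳ-≈ v≈v′ u<v))))
  ... | tri≈ _ u≈v _ = sym (colour-≈ (P₀.Eq.trans (P₀.Eq.sym u≈u′) (P₀.Eq.trans u≈v v≈v′)))
  ... | tri> _ _ v<u = trans (Func.cong f₀ (v≈v′ , u≈u′))
                             (sym (colour-> (P₀.<-respˡ-≈ v≈v′ (P₀.<-respʳ-≈ u≈u′ v<u))))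

  pullback : Colouring P
  pullback = record
    { to   = λ (x , y , _) → colour (to x) (to y)
    ; cong = λ (x≈x′ , y≈y′) → colour-cong (to-cong x≈x′) (to-cong y≈y′)
    }

  Image : Pred P.Carrier 0ℓ → Pred P₀.Carrier 0ℓ
  Image X z = ∃[ x ] X x × to x P₀.≈ z

  homogeneous-image : ∀ {c X} → Homogeneous P pullback c X → Homogeneous P₀ f₀ c (Image X)
  homogeneous-image hom u v u<v (x , Xx , hx≈u) (y , Xy , hy≈v) with P.compare x y
  ... | tri< x<y _ _ = trans (sym (colour-< u<v))
                             (trans (sym (colour-cong hx≈u hy≈v)) (hom x y x<y Xx Xy))
  ... | tri≈ _ x≈y _ = contradiction u<v (P₀.irrefl
                         (P₀.Eq.trans (P₀.Eq.sym hx≈u) (P₀.Eq.trans (to-cong x≈y) hy≈v)))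
  ... | tri> _ _ y<x = trans (sym (colour-> u<v))
                             (trans (sym (colour-cong hy≈v hx≈u)) (hom y x y<x Xy Xx))

  bijection-image : ∀ {X n} → Bijection ∣ P ↾ X ∣ (setoid (Fin n)) →
                    Bijection ∣ P₀ ↾ Image X ∣ (setoid (Fin n))
  bijection-image {X} b = record
    { to        = λ (_ , x , Xx , _) → B.to (x , Xx)
    ; cong      = λ {u} {v} → cong-image {u} {v}
    ; bijective =
        (λ {(_ , _ , _ , hx≈u)} {(_ , _ , _ , hy≈v)} eq →
          P₀.Eq.trans (P₀.Eq.sym hx≈u) (P₀.Eq.trans (to-cong (B.injective eq)) hy≈v))
      , λ i → let (x , Xx) , hits = B.surjective i in
          (to x , x , Xx , P₀.Eq.refl) ,
          λ { {_ , y , Xy , hy≈v} v≈hx → hits {y , Xy} (injective (P₀.Eq.trans hy≈v v≈hx)) }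
    }
    where
    module B = Bijection b
    cong-image : ∀ {u v : StrictTotalOrder.Carrier (P₀ ↾ Image X)} → proj₁ u P₀.≈ proj₁ v →
                 B.to (proj₁ (proj₂ u) , proj₁ (proj₂ (proj₂ u))) ≡ B.to (proj₁ (proj₂ v) , proj₁ (proj₂ (proj₂ v)))
    cong-image {_ , _ , _ , hx≈u} {_ , _ , _ , hy≈v} u≈v =
      B.cong (injective (P₀.Eq.trans hx≈u (P₀.Eq.trans u≈v (P₀.Eq.sym hy≈v))))

-- Copies of ω₁ⁿ in ω₁^ω and transfer to ω₁ω.

module Main (em : ∀ ℓ → ExcludedMiddle ℓ) (ext : ∀ a b → Extensionality a b)
            (ω₁ : LinearOrder) (isω₁ : Isω₁ ω₁) where
  open Decomposition em ext ω₁ isω₁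
  private module ω = Order ω₁

  module Range (L P : LinearOrder) (E : StrictTotalOrder.Carrier L → StrictTotalOrder.Carrier P)
    (E-mono : ∀ {x y} → StrictTotalOrder._<_ L x y → StrictTotalOrder._<_ P (E x) (E y)) where
    private
      module L = Order L
      module P = Order P
    open Canonical ∣ L ∣

    -- Only values at canonical points are taken, because `E` need not send equal points to equal
    -- points.
    range : Pred P.Carrier 0ℓ
    range z = ∃[ l ] E (canon l) P.≈ z

    canonical-mono : ∀ {l m} → l L.< m → E (canon l) P.< E (canon m)
    canonical-mono l<m = E-mono (L.<-respˡ-≈ (L.Eq.sym (canon-≈ _)) (L.<-respʳ-≈ (L.Eq.sym (canon-≈ _)) l<m))

    canonical-cong : ∀ {l m} → l L.≈ m → E (canon l) P.≈ E (canon m)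
    canonical-cong l≈m = P.Eq.reflexive (cong E (canon-cong l≈m))

    canonical-injective : ∀ {l m} → E (canon l) P.≈ E (canon m) → l L.≈ m
    canonical-injective = L.increasing⇒injective P (E ∘ canon) canonical-mono

    canonical-cancel : ∀ {l m} → E (canon l) P.< E (canon m) → l L.< m
    canonical-cancel {l} {m} El<Em with L.compare l m
    ... | tri< l<m _ _ = l<m
    ... | tri≈ _ l≈m _ = contradiction El<Em (P.irrefl (canonical-cong l≈m))
    ... | tri> _ _ m<l = contradiction (canonical-mono m<l) (P.<⇒≤ El<Em)

    range≅ : (P ↾ range) ≅ L
    range≅ = (λ (_ , l , _) → l) , record
      { isOrderMonomorphism = record
        { isOrderHomomorphism = record
          { cong = λ {u} {v} u≈v → canonical-injective
                     (P.Eq.trans (proj₂ (proj₂ u)) (P.Eq.trans u≈v (P.Eq.sym (proj₂ (proj₂ v)))))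
          ; mono = λ {u} {v} u<v → canonical-cancel
                     (P.<-respˡ-≈ (P.Eq.sym (proj₂ (proj₂ u))) (P.<-respʳ-≈ (P.Eq.sym (proj₂ (proj₂ v))) u<v))
          }
        ; injective = λ {u} {v} l≈m →
            P.Eq.trans (P.Eq.sym (proj₂ (proj₂ u))) (P.Eq.trans (canonical-cong l≈m) (proj₂ (proj₂ v)))
        ; cancel = λ {u} {v} l<m →
            P.<-respˡ-≈ (proj₂ (proj₂ u)) (P.<-respʳ-≈ (proj₂ (proj₂ v)) (canonical-mono l<m))
        }
      ; surjective = λ l → (E (canon l) , l , P.Eq.refl) ,
          λ {v} v≈El → canonical-injective (P.Eq.trans (proj₂ (proj₂ v)) v≈El)
      }

  open Power ω₁ using (C; _<ᵉ_)

  private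
    bottom : ∃[ a ] ⊤ × (∀ {b} → ⊤ → a ω.≤ b)
    bottom = minimal (λ a → a) (w₀ , tt)

  -- The leading coordinate of ω₁ⁿ⁺¹ becomes the digit at `n`, and digits beyond are least, so
  -- lexicographic order turns into comparison at the greatest difference.
  digits : ∀ n → Index n → ℕ → W
  digits zero    _       _ = proj₁ bottom
  digits (suc n) (a , l) k with k ℕₚ.≟ n
  ... | yes _ = a
  ... | no _  = digits n l k

  digits-support : ∀ n l k → n ℕ.≤ k → digits n l k ≡ proj₁ bottom
  digits-support zero    _       _ _   = refl
  digits-support (suc n) (a , l) k n<k with k ℕₚ.≟ n
  ... | yes refl = contradiction n<k (ℕₚ.<-irrefl refl)
  ... | no _     = digits-support n l k (ℕₚ.<⇒≤ n<k)

  digits-mono : ∀ n {l m} → Lex n l m →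
    ∃[ k ] k ℕ.< n × digits n l k ω.< digits n m k × (∀ j → k ℕ.< j → digits n l j ≡ digits n m j)
  digits-mono (suc n) {a , l} {b , m} (inj₁ a<b) = n , ℕₚ.≤-refl , top , above
    where
    top : digits (suc n) (a , l) n ω.< digits (suc n) (b , m) n
    top with n ℕₚ.≟ n
    ... | yes _  = a<b
    ... | no n≢n = contradiction refl n≢n
    above : ∀ j → n ℕ.< j → digits (suc n) (a , l) j ≡ digits (suc n) (b , m) j
    above j n<j = trans (digits-support (suc n) (a , l) j n<j) (sym (digits-support (suc n) (b , m) j n<j))
  digits-mono (suc n) {a , l} {.a , m} (inj₂ (refl , l<m)) with digits-mono n l<m
  ... | k , k<n , lk<mk , above = k , ℕₚ.m<n⇒m<1+n k<n , at-k , above′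
    where
    at-k : digits (suc n) (a , l) k ω.< digits (suc n) (a , m) k
    at-k with k ℕₚ.≟ n
    ... | yes refl = contradiction k<n (ℕₚ.<-irrefl refl)
    ... | no _     = lk<mk
    above′ : ∀ j → k ℕ.< j → digits (suc n) (a , l) j ≡ digits (suc n) (a , m) j
    above′ j k<j with j ℕₚ.≟ n
    ... | yes _ = refl
    ... | no _  = above j k<j

  power : ∀ n → Index n → C
  power n l = digits n l , n , λ k n≤k b →
    subst (ω._≤ b) (sym (digits-support n l k n≤k)) (proj₂ (proj₂ bottom) tt)

  power-mono : ∀ n {l m} → Lex n l m → power n l <ᵉ power n m
  power-mono n l<m with digits-mono n l<m
  ... | k , _ , lk<mk , above = k , lk<mk , λ j k<j → ω.Eq.reflexive (above j k<j)

  module _ (P : LinearOrder) {Q : Pred (StrictTotalOrder.Carrier P) 0ℓ} where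
    open Order P

    ω₁^ω-copy : (P ↾ Q) ≅ ω₁ ^ω → ∀ n → Copy _<_ n Q
    ω₁^ω-copy iso n = copy (proj₁ ∘ from ∘ power n) (proj₂ ∘ from ∘ power n) (λ l<m → from-mono (power-mono n l<m))
      where open Inverse {P ↾ Q} {ω₁ ^ω} iso

    ω₁^ω*-copy : (P ↾ Q) ≅ (ω₁ ^ω) * → ∀ n → Copy (flip _<_) n Q
    ω₁^ω*-copy iso n = copy (proj₁ ∘ from ∘ power n) (proj₂ ∘ from ∘ power n) (λ l<m → from-mono (power-mono n l<m))
      where open Inverse {P ↾ Q} {(ω₁ ^ω) *} iso

  module Transfer (P : LinearOrder) (e : ∣ P ∣ ≲ ∣ ω₁ ∣)
                  (σ : σSmall (StrictTotalOrder._<_ P) (λ _ → ⊤))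
                  (P₀ : LinearOrder) (P₀≅ : P₀ ≅ ω₁ ·ω) where
    open Order P
    open Canonical ∣ P ∣
    open Bounded P e
    private
      module P₀ = Order P₀
      module J = Inverse {P₀} {ω₁ ·ω} P₀≅
      module e = Injection e

    -- Composing with `canon` makes the class number respect equality, as the map `h` requires.
    r : Carrier → ℕ
    r = σSmall.rank σ ∘ canon

    r-small : ∀ n → Small _<_ n (λ x → r x ≡ n)
    r-small n = small
      (λ (copy E E∈ mono) → Small.no-copy (σSmall.rank-small σ n)
        (copy (canon ∘ E) (λ l → tt , E∈ l) (canon-mono ∘ mono)))
      (λ (copy E E∈ mono) → Small.no-reverse-copy (σSmall.rank-small σ n)
        (copy (canon ∘ E) (λ l → tt , E∈ l) (canon-mono ∘ mono)))
      where
      canon-mono : ∀ {x y} → x < y → canon x < canon y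
      canon-mono x<y = <-respˡ-≈ (Eq.sym (canon-≈ _)) (<-respʳ-≈ (Eq.sym (canon-≈ _)) x<y)

    h : ∣ P ∣ ≲ ∣ P₀ ∣
    h = record
      { to        = λ x → J.from (r x , e.to x)
      ; cong      = λ x≈y → J.from-cong (cong (σSmall.rank σ) (canon-cong x≈y) , e.cong x≈y)
      ; injective = λ eq → e.injective (proj₂ (J.from-injective eq))
      }

    -- Classes up to `N` are small by rank, later ones are 1-small by countability. The bound
    -- `suc N` is at least 1 even when `N` is 0.
    countable-tail⇒small : ∀ {Q} N → (∀ n → N ℕ.≤ n → Countable ∣ P ∣ (λ x → Q x × r x ≡ n)) →
                           Small _<_ (suc N) Q
    countable-tail⇒small {Q} N count = small-⊆ (λ Qx → _ , Qx , refl) (small-⋃ piece)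
      where
      piece : ∀ n → Small _<_ (suc N) (λ x → Q x × r x ≡ n)
      piece n with ℕₚ.≤-total N n
      ... | inj₁ N≤n = small-mono (ℕₚ.≤⇒≤′ (ℕ.s≤s ℕ.z≤n)) (countable⇒small (count n N≤n))
      ... | inj₂ n≤N = small-mono (ℕₚ.≤⇒≤′ (ℕₚ.m≤n⇒m≤1+n n≤N)) (small-⊆ proj₂ (r-small n))

    module _ {Q : Pred Carrier 0ℓ} (¬small : ∀ n → ¬ Small _<_ n Q) where

      uncountable-class : ∀ N → ∃[ n ] N ℕ.≤ n × ¬ Countable ∣ P ∣ (λ x → Q x × r x ≡ n)
      uncountable-class N = dne λ ¬∃ → ¬small (suc N)
        (countable-tail⇒small N λ n N≤n → dne λ ¬count → ¬∃ (n , N≤n , ¬count))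

      class : ℕ → ℕ
      class zero    = proj₁ (uncountable-class 0)
      class (suc k) = proj₁ (uncountable-class (suc (class k)))

      class-uncountable : ∀ k → ¬ Countable ∣ P ∣ (λ x → Q x × r x ≡ class k)
      class-uncountable zero    = proj₂ (proj₂ (uncountable-class 0))
      class-uncountable (suc k) = proj₂ (proj₂ (uncountable-class (suc (class k))))

      class-mono : ∀ {i j} → i ℕ.<′ j → class i ℕ.< class j
      class-mono {i} ℕ.≤′-refl = proj₁ (proj₂ (uncountable-class (suc (class i))))
      class-mono {i} {suc j} (ℕ.≤′-step i<j) =
        ℕₚ.<-trans (class-mono i<j) (proj₁ (proj₂ (uncountable-class (suc (class j)))))

      G : ℕ → W → Carrier
      G k = proj₁ (uncountable-enumerate (class-uncountable k))

      G∈ : ∀ k a → Q (G k a) × r (G k a) ≡ class k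
      G∈ k = proj₁ (proj₂ (uncountable-enumerate (class-uncountable k)))

      G-mono : ∀ k {a b} → a ω.< b → e.to (G k a) ω.< e.to (G k b)
      G-mono k = proj₂ (proj₂ (uncountable-enumerate (class-uncountable k)))

      E : ℕ × W → P₀.Carrier
      E (k , a) = Injection.to h (G k a)

      -- In ω₁ω the point `E (k , a)` has copy number `class k` and place `e.to (G k a)`, increasing
      -- in `k` and in `a` respectively.
      E-mono : ∀ {p q} → StrictTotalOrder._<_ (ω₁ ·ω) p q → E p P₀.< E q
      E-mono {k , a} {k′ , a′} (inj₁ k<k′) = J.from-mono (inj₁
        (subst₂ ℕ._<_ (sym (proj₂ (G∈ k a))) (sym (proj₂ (G∈ k′ a′))) (class-mono (ℕₚ.<⇒<′ k<k′))))
      E-mono {k , a} {.k , a′} (inj₂ (refl , a<a′)) =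
        J.from-mono (inj₂ (trans (proj₂ (G∈ k a)) (sym (proj₂ (G∈ k a′))) , G-mono k a<a′))

    module _ (f₀ : Colouring P₀) where
      open Pullback P P₀ h f₀

      -- Uncountable traces of `Q` on infinitely many classes spell out ω₁ω inside its image, and
      -- homogeneity passes to images.
      transfer : ∀ {Q c} → (∀ n → ¬ Small _<_ n Q) → Homogeneous P pullback c Q →
                 Σ[ X ∈ Pred P₀.Carrier 0ℓ ] (P₀ ↾ X) ≅ ω₁ ·ω × Homogeneous P₀ f₀ c X
      transfer {Q} ¬small hom = range , range≅ , λ u v u<v u∈ v∈ →
        homogeneous-image {X = Q} hom u v u<v (range⊆ u∈) (range⊆ v∈)
        where
        open Range (ω₁ ·ω) P₀ (E ¬small) (E-mono ¬small)
        open Canonical ∣ ω₁ ·ω ∣ using () renaming (canon to canonᴸ)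
        range⊆ : range ⊆ Image Q
        range⊆ (l , El≈z) = let k , a = canonᴸ l in G ¬small k a , proj₁ (G∈ ¬small k a) , El≈z

      -- Type ω₁^ω contains every ω₁ⁿ and its reverse every reversed ω₁ⁿ, so colour 0 falls under
      -- `transfer`; a triple in colour 1 is carried over by `h`.
      conclude :
          (∃[ i ] Σ[ Q ∈ Pred Carrier 0ℓ ]
             (P ↾ Q) ≅ ((ω₁ ^ω) ∷ ((ω₁ ^ω) *) ∷ []) i × Homogeneous P pullback fzero Q)
        ⊎ (Σ[ Q ∈ Pred Carrier 0ℓ ]
             Bijection ∣ P ↾ Q ∣ (setoid (Fin 3)) × Homogeneous P pullback (fsuc fzero) Q) →
          (∃[ i ] Σ[ Q ∈ Pred P₀.Carrier 0ℓ ]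
             (P₀ ↾ Q) ≅ ((ω₁ ·ω) ∷ []) i × Homogeneous P₀ f₀ fzero Q)
        ⊎ (Σ[ Q ∈ Pred P₀.Carrier 0ℓ ]
             Bijection ∣ P₀ ↾ Q ∣ (setoid (Fin 3)) × Homogeneous P₀ f₀ (fsuc fzero) Q)
      conclude (inj₁ (fzero , Q , Q≅ , hom)) =
        inj₁ (fzero , transfer (λ n s → Small.no-copy s (ω₁^ω-copy P Q≅ n)) hom)
      conclude (inj₁ (fsuc fzero , Q , Q≅ , hom)) =
        inj₁ (fzero , transfer (λ n s → Small.no-reverse-copy s (ω₁^ω*-copy P Q≅ n)) hom)
      conclude (inj₂ (Q , bijection , hom)) =
        inj₂ (Image Q , bijection-image bijection , homogeneous-image hom)

theorem5p9 : (∀ ℓ → ExcludedMiddle ℓ) →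
    (∀ a b → Extensionality a b) →
    (ω₁ : LinearOrder) → Isω₁ ω₁ →
    (ω₁ ·ω) ⟶̸[ (ω₁ ·ω) ∷ [] , 3 ]² →
    (τ : LinearOrder) →
    ⟨ ω₁ , ω₁ ⟩-Scattered τ →
    ∣ τ ∣ ≲ ∣ ω₁ ∣ →
    τ ⟶̸[ (ω₁ ^ω) ∷ ((ω₁ ^ω) *) ∷ [] , 3 ]²
theorem5p9 em ext ω₁ isω₁ ω₁·ω⟶̸ τ (P , P≅τ , ν , F , scattered , covers) τ≲ω₁ τ⟶ = ω₁·ω⟶̸ ω₁·ω⟶
  where
  open Main em ext ω₁ isω₁
  open Decomposition em ext ω₁ isω₁

  e : ∣ P ∣ ≲ ∣ ω₁ ∣
  e = record
    { to        = Injection.to τ≲ω₁ ∘ proj₁ P≅τ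
    ; cong      = Injection.cong τ≲ω₁ ∘ IsOrderIsomorphism.cong (proj₂ P≅τ)
    ; injective = IsOrderIsomorphism.injective (proj₂ P≅τ) ∘ Injection.injective τ≲ω₁
    }

  ω₁·ω⟶ : (ω₁ ·ω) ⟶[ (ω₁ ·ω) ∷ [] , 3 ]²
  ω₁·ω⟶ P₀ P₀≅ f₀ = conclude f₀ (τ⟶ P P≅τ (Pullback.pullback P P₀ h f₀))
    where open Transfer P e (union-σSmall P e ν F scattered covers) P₀ P₀≅
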